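{- Let $n\ge2$. For every limit ordinal $\alpha\ge\omega$, the relation $H(x,y)$, which holds iff $\operatorname{ht}(x)=\operatorname{ht}(y)$, is not definable by a first-order formula in the structure $\mathfrak T_\alpha^n$; that is, there is no first-order formula $\varphi(x,y)$ in the language $\{\subseteq,S_0,\dots,S_{n-1}\}$ such that for all nodes $x,y$, $\mathfrak T_\alpha^n\models\varphi(x,y)$ iff $\operatorname{ht}(x)=\operatorname{ht}(y)$.
   Context: $\mathfrak T_\alpha^n=(n^{<\alpha},\subseteq,S_0,\dots,S_{n-1})$, where $n^{<\alpha}$ is the set of all functions $s:\beta\to n=\{0,\dots,n-1\}$ with $\beta<\alpha$, $\subseteq$ is the initial-segment (inclusion) order, and $S_i(s)$ is $s$ extended by one further entry $i$. The height $\operatorname{ht}(s)$ is the domain $\beta$ of $s$. -}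

module Defs where

open import Data.Empty.Polymorphic using (⊥)
open import Data.Fin using (Fin)
open import Data.Nat using (ℕ; suc)
open import Data.Product using (Σ; _×_; _,_; ∃)
open import Data.Sum using (_⊎_)
open import Data.Vec using (Vec; []; _∷_; lookup)
open import Function.Bundles using (_⇔_)
open import Induction.WellFounded using (WellFounded)
open import Level using (Level; Lift; _⊔_) renaming (suc to lsuc)
open import Relation.Binary using (Rel; IsEquivalence; IsStrictTotalOrder; _Respects₂_)
open import Relation.Binary.PropositionalEquality using (_≡_; refl; sym; trans)
open import Relation.Nullary using (¬_; yes; no)

private
  variable
    a c e r ℓ : Level
    n k : ℕ

-- First-order logic with equality over the language {⊆, S₀, …, Sₙ₋₁}.

data Term (n k : ℕ) : Set where
  var : Fin k → Term n k
  S   : Fin n → Term n k → Term n k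

infix  6 _≐_ _⊆′_
infixr 5 _∧′_
infixr 4 _∨′_
infixr 3 _⇒′_

-- Formulas whose free variables are among k variables (de Bruijn indices).
data Formula (n : ℕ) : ℕ → Set where
  _≐_ _⊆′_            : Term n k → Term n k → Formula n k
  ⊥′                  : Formula n k
  ¬′_                 : Formula n k → Formula n k
  _∧′_ _∨′_ _⇒′_      : Formula n k → Formula n k → Formula n k
  ∀′_ ∃′_             : Formula n (suc k) → Formula n k

-- The domain is a setoid; the equality symbol is interpreted by _≈_.
record Structure (n : ℕ) (c e r : Level) : Set (lsuc (c ⊔ e ⊔ r)) where
  infix 4 _≈_ _⊆_
  field
    Carrier       : Set c
    _≈_           : Rel Carrier e
    _⊆_           : Rel Carrier r
    succ          : Fin n → Carrier → Carrier
    isEquivalence : IsEquivalence _≈_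
    ⊆-resp-≈      : _⊆_ Respects₂ _≈_
    succ-cong     : ∀ i {x y} → x ≈ y → succ i x ≈ succ i y

module Semantics (M : Structure n c e r) where
  open Structure M

  ⟦_⟧ : Term n k → Vec Carrier k → Carrier
  ⟦ var x ⟧ ρ = lookup ρ x
  ⟦ S i t ⟧ ρ = succ i (⟦ t ⟧ ρ)

  infix 2 _⊨_
  _⊨_ : Vec Carrier k → Formula n k → Set (c ⊔ e ⊔ r)
  ρ ⊨ (s ≐ t)   = Lift (c ⊔ r) (⟦ s ⟧ ρ ≈ ⟦ t ⟧ ρ)
  ρ ⊨ (s ⊆′ t)  = Lift (c ⊔ e) (⟦ s ⟧ ρ ⊆ ⟦ t ⟧ ρ)
  ρ ⊨ ⊥′        = ⊥
  ρ ⊨ (¬′ φ)    = ¬ (ρ ⊨ φ)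
  ρ ⊨ (φ ∧′ ψ)  = (ρ ⊨ φ) × (ρ ⊨ ψ)
  ρ ⊨ (φ ∨′ ψ)  = (ρ ⊨ φ) ⊎ (ρ ⊨ ψ)
  ρ ⊨ (φ ⇒′ ψ)  = (ρ ⊨ φ) → (ρ ⊨ ψ)
  ρ ⊨ (∀′ φ)    = ∀ x → x ∷ ρ ⊨ φ
  ρ ⊨ (∃′ φ)    = ∃ λ x → x ∷ ρ ⊨ φ

-- Parameter-free definability of a binary relation.
Definable₂ : (M : Structure n c e r) → Rel (Structure.Carrier M) ℓ → Set (c ⊔ e ⊔ r ⊔ ℓ)
Definable₂ {n = n} M R =
  Σ (Formula n 2) λ φ → ∀ x y → (x ∷ y ∷ [] ⊨ φ) ⇔ R x y
  where open Semantics M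

-- An ordinal α is presented by a well-order of type α; the elements of the
-- carrier are (in bijection with) the ordinals β < α.
record WellOrder (a ℓ : Level) : Set (lsuc (a ⊔ ℓ)) where
  infix 4 _<_
  field
    Carrier            : Set a
    _<_                : Rel Carrier ℓ
    isStrictTotalOrder : IsStrictTotalOrder _≡_ _<_
    wellFounded        : WellFounded _<_
  open IsStrictTotalOrder isStrictTotalOrder public using (_<?_)

-- α ≠ 0, and β < α implies β + 1 < α; such an α automatically satisfies α ≥ ω.
record IsLimit (α : WellOrder a ℓ) : Set (a ⊔ ℓ) where
  open WellOrder α
  field
    nonempty  : Carrier
    _+1       : Carrier → Carrier
    β<β+1     : ∀ β → β < β +1
    +1-least  : ∀ {β γ} → β < γ → ¬ (γ < β +1)

module Tree (n : ℕ) (α : WellOrder a ℓ) where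
  open WellOrder α

  -- A function ht → n, where the ordinal ht < α is the set of ordinals below it.
  -- The bound is irrelevant so that the value depends on β alone.
  record Node : Set (a ⊔ ℓ) where
    constructor node
    field
      ht    : Carrier
      entry : ∀ β → .(β < ht) → Fin n
  open Node public

  infix 4 _≈_ _⊆_

  -- Extensional equality of functions.
  _≈_ : Rel Node (a ⊔ ℓ)
  s ≈ t = ht s ≡ ht t ×
          (∀ β (p : β < ht s) (q : β < ht t) → entry s β p ≡ entry t β q)

  -- Inclusion of graphs.
  _⊆_ : Rel Node (a ⊔ ℓ)
  s ⊆ t = ∀ β (p : β < ht s) → Σ (β < ht t) λ q → entry s β p ≡ entry t β q

  H : Rel Node a
  H x y = ht x ≡ ht y

  ≈-isEquivalence : IsEquivalence _≈_
  ≈-isEquivalence = record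
    { refl  = refl , λ _ _ _ → refl
    ; sym   = λ (h , f) → sym h , λ β p q → sym (f β q p)
    ; trans = λ { (refl , f) (refl , g) → refl , λ β p q → trans (f β p p) (g β p q) }
    }

  ⊆-resp-≈ : _⊆_ Respects₂ _≈_
  ⊆-resp-≈ =
      (λ { (refl , f) s⊆t β p → let (q , eq) = s⊆t β p in q , trans eq (f β q q) })
    , (λ { (refl , f) s⊆t β p → let (q , eq) = s⊆t β p in q , trans (sym (f β p p)) eq })

  module _ (lim : IsLimit α) where
    open IsLimit lim

    extendEntry : (s : Node) → Fin n → Carrier → Fin n
    extendEntry s i β with β <? ht s
    ... | yes β<ht = entry s β β<ht
    ... | no  _    = i

    extend : Fin n → Node → Node
    extend i s = node (ht s +1) (λ β _ → extendEntry s i β)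

    extend-cong : ∀ i {s t} → s ≈ t → extend i s ≈ extend i t
    extend-cong i {s} {t} (refl , f) = refl , λ β _ _ → go β
      where
      go : ∀ β → extendEntry s i β ≡ extendEntry t i β
      go β with β <? ht s
      ... | yes β<ht = f β β<ht β<ht
      ... | no  _    = refl

    𝔗 : Structure n (a ⊔ ℓ) (a ⊔ ℓ) (a ⊔ ℓ)
    𝔗 = record
      { Carrier       = Node
      ; _≈_           = _≈_
      ; _⊆_           = _⊆_
      ; succ          = extend
      ; isEquivalence = ≈-isEquivalence
      ; ⊆-resp-≈      = ⊆-resp-≈
      ; succ-cong     = extend-cong
      }

{-# OPTIONS --safe #-}
-- No formula distinguishes the pair (0ᴷ, 1ᴷ) from (0ᴷ, 1ᴷ⁺¹) once the finite
-- number K is large compared with the formula.  Inserting one more letter 1 into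
-- the nodes extending 1ᵇ, and fixing the nodes not extending 1ᵃ, is a partial
-- isomorphism as long as a ≤ b; every quantifier costs the Duplicator half of the
-- gap between a and b, because a new node either extends 1ᵐ, m being the middle of
-- the gap, or does not.
module Submission where

open import Defs
open import Axiom.ExcludedMiddle using (ExcludedMiddle)
open import Data.Fin using (Fin; zero; suc)
open import Data.Nat as ℕ using (ℕ; zero; suc; _+_; _≤_; s≤s; z≤n)
import Data.Nat.Properties as ℕ
open import Data.Product using (∃; _×_; _,_; proj₁; proj₂; map₂)
open import Data.Sum using (_⊎_; inj₁; inj₂; [_,_]′)
import Data.Product as Product
import Data.Sum as Sum
open import Data.Vec using (Vec; []; _∷_)
open import Data.Vec.Relation.Binary.Pointwise.Inductive as Pointwise
  using (Pointwise; []; _∷_)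
open import Function using (_∘_; id)
open import Function.Bundles using (_⇔_; mk⇔; Equivalence)
open import Function.Properties.Equivalence using () renaming (sym to ⇔-sym; trans to ⇔-trans)
open import Induction.WellFounded using (Acc; acc)
open import Level using (Level; _⊔_; lift)
open import Relation.Binary using (IsStrictTotalOrder; tri<; tri≈; tri>)
open import Relation.Binary.PropositionalEquality
  using (_≡_; _≢_; refl; sym; trans; cong; subst)
open import Relation.Nullary using (¬_; yes; no; contradiction)

open Equivalence using (to; from)

private
  variable
    a ℓ : Level
    n k : ℕ

-- Syntactic measures of terms and formulas.

depth : Term n k → ℕ
depth (var _) = 0
depth (S _ t) = suc (depth t)

-- A gap of this width lets the Duplicator win the game for the formula; a quantifier
-- splits the gap into two parts, each of which must suffice for the body.
rank : Formula n k → ℕ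
rank (s ≐ t)  = depth s ℕ.⊔ depth t
rank (s ⊆′ t) = depth s ℕ.⊔ depth t
rank ⊥′       = 0
rank (¬′ φ)   = rank φ
rank (φ ∧′ ψ) = rank φ ℕ.⊔ rank ψ
rank (φ ∨′ ψ) = rank φ ℕ.⊔ rank ψ
rank (φ ⇒′ ψ) = rank φ ℕ.⊔ rank ψ
rank (∀′ φ)   = suc (rank φ + rank φ)
rank (∃′ φ)   = suc (rank φ + rank φ)

-- Ordinals below a limit: zero, the finite ones, and the map `1 + β`.

module LimitOrdinal (em : ExcludedMiddle (a ⊔ ℓ)) (α : WellOrder a ℓ) (lim : IsLimit α) where
  open WellOrder α
  open IsLimit lim
  open IsStrictTotalOrder isStrictTotalOrder public
    using (compare) renaming (trans to <-trans; irrefl to <-irrefl)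

  -- `IsLimit` supplies only some element, so zero is reached by descent: excluded middle finds a
  -- smaller element or certifies minimality, and accessibility ends the search.
  minimum : ∀ β → Acc _<_ β → ∃ λ μ → ∀ γ → ¬ (γ < μ)
  minimum β (acc rec) with em {∃ λ γ → γ < β}
  ... | yes (γ , γ<β) = minimum γ (rec γ<β)
  ... | no  none      = β , λ γ γ<β → none (γ , γ<β)

  0̂ : Carrier
  0̂ = proj₁ (minimum nonempty (wellFounded nonempty))

  ≮0̂ : ∀ {β} → ¬ (β < 0̂)
  ≮0̂ = proj₂ (minimum nonempty (wellFounded nonempty)) _

  fin : ℕ → Carrier
  fin zero    = 0̂
  fin (suc k) = fin k +1

  <-≮-trans : ∀ {β γ δ} → β < γ → ¬ (δ < γ) → β < δ
  <-≮-trans {β} {γ} {δ} β<γ δ≮γ with compare β δ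
  ... | tri< β<δ _ _    = β<δ
  ... | tri≈ _ refl _   = contradiction β<γ δ≮γ
  ... | tri> _ _ δ<β    = contradiction (<-trans δ<β β<γ) δ≮γ

  <+1⇒≯ : ∀ {β γ} → γ < β +1 → ¬ (β < γ)
  <+1⇒≯ γ<β+1 β<γ = +1-least β<γ γ<β+1

  +1-mono-< : ∀ {β γ} → β < γ → (β +1) < (γ +1)
  +1-mono-< {β} {γ} β<γ with compare (β +1) (γ +1)
  ... | tri< p _ _ = p
  ... | tri≈ _ p _ = contradiction (subst (γ <_) (sym p) (β<β+1 γ)) (+1-least β<γ)
  ... | tri> _ _ p = contradiction (<-trans (β<β+1 γ) p) (+1-least β<γ)

  0̂<+1 : ∀ β → 0̂ < (β +1)
  0̂<+1 β = <-≮-trans (β<β+1 0̂) λ p → ≮0̂ (<-≮-trans (β<β+1 β) (<+1⇒≯ p))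

  fin-mono : ∀ {j k} → j ≤ k → ∀ {β} → β < fin j → β < fin k
  fin-mono j≤k = go (ℕ.≤⇒≤′ j≤k)
    where
    go : ∀ {j k} → j ℕ.≤′ k → ∀ {β} → β < fin j → β < fin k
    go ℕ.≤′-refl       β<j = β<j
    go (ℕ.≤′-step j≤k) β<j = <-trans (go j≤k β<j) (β<β+1 _)

  -- Placed at the level where `em` decides it; matching also returns the number `k`.
  data Finite : Carrier → Set (a ⊔ ℓ) where
    finite : ∀ k → Finite (fin k)

  Finite-+1 : ∀ {β} → Finite β → Finite (β +1)
  Finite-+1 (finite k) = finite (suc k)

  <fin⇒Finite : ∀ {β} k → β < fin k → Finite β
  <fin⇒Finite zero β<0 = contradiction β<0 ≮0̂
  <fin⇒Finite {β} (suc k) β<k+1 with compare β (fin k)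
  ... | tri< β<k _ _  = <fin⇒Finite k β<k
  ... | tri≈ _ refl _ = finite k
  ... | tri> _ _ k<β  = contradiction k<β (<+1⇒≯ β<k+1)

  Finite-< : ∀ {β γ} → β < γ → Finite γ → Finite β
  Finite-< β<k (finite k) = <fin⇒Finite k β<k

  -- Ordinal addition 1 + β: an isomorphism of α onto α ∖ {0}.
  1+_ : Carrier → Carrier
  1+ β with em {Finite β}
  ... | yes _ = β +1
  ... | no  _ = β

  1+-finite : ∀ {β} → Finite β → 1+ β ≡ β +1
  1+-finite {β} fin-β with em {Finite β}
  ... | yes _  = refl
  ... | no inf = contradiction fin-β inf

  1+-infinite : ∀ {β} → ¬ Finite β → 1+ β ≡ β
  1+-infinite {β} inf with em {Finite β}
  ... | yes fin-β = contradiction fin-β inf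
  ... | no  _     = refl

  1+-mono-< : ∀ {β γ} → β < γ → (1+ β) < (1+ γ)
  1+-mono-< {β} {γ} β<γ with em {Finite β} | em {Finite γ}
  ... | yes _     | yes _     = +1-mono-< β<γ
  ... | no  inf   | yes fin-γ = contradiction (Finite-< β<γ fin-γ) inf
  ... | no  _     | no  _     = β<γ
  -- Leastness gives `β +1` ≤ `γ`, and equality would make `γ` finite.
  ... | yes fin-β | no  inf with compare (β +1) γ
  ...   | tri< p _ _    = p
  ...   | tri≈ _ refl _ = contradiction (Finite-+1 fin-β) inf
  ...   | tri> _ _ p    = contradiction p (+1-least β<γ)

  1+-cancel-< : ∀ {β γ} → (1+ β) < (1+ γ) → β < γ
  1+-cancel-< {β} {γ} p with compare β γ
  ... | tri< q _ _    = q
  ... | tri≈ _ refl _ = contradiction p (<-irrefl refl)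
  ... | tri> _ _ q    = contradiction (<-trans p (1+-mono-< q)) (<-irrefl refl)

  1+-injective : ∀ {β γ} → 1+ β ≡ 1+ γ → β ≡ γ
  1+-injective {β} {γ} eq with compare β γ
  ... | tri< q _ _ = contradiction (1+-mono-< q) (<-irrefl eq)
  ... | tri≈ _ q _ = q
  ... | tri> _ _ q = contradiction (1+-mono-< q) (<-irrefl (sym eq))

  -- Associativity of 1 + β + 1, by which prepending a letter commutes with appending one.
  1+-+1 : ∀ β → 1+ (β +1) ≡ (1+ β) +1
  1+-+1 β with em {Finite β}
  ... | yes fin-β = 1+-finite (Finite-+1 fin-β)
  ... | no  inf   = 1+-infinite (inf ∘ Finite-< (β<β+1 β))

  0̂<1+ : ∀ β → 0̂ < (1+ β)
  0̂<1+ β with em {Finite β}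
  ... | yes _ = 0̂<+1 β
  ... | no inf with compare 0̂ β
  ...   | tri< p _ _    = p
  ...   | tri≈ _ refl _ = contradiction (finite 0) inf
  ...   | tri> _ _ p    = contradiction p ≮0̂

  data View : Carrier → Set a where
    zero : View 0̂
    suc  : ∀ β → View (1+ β)

  -- A finite nonzero ordinal gives its predecessor; an infinite one is its own `1+_` preimage.
  view : ∀ β → View β
  view β with em {Finite β}
  ... | yes (finite zero)    = zero
  ... | yes (finite (suc k)) = subst View (1+-finite (finite k)) (suc (fin k))
  ... | no  inf              = subst View (1+-infinite inf) (suc β)

module Game (em : ExcludedMiddle (a ⊔ ℓ)) (α : WellOrder a ℓ) (lim : IsLimit α)
            {n : ℕ} (i : Fin n) where
  open LimitOrdinal em α lim
  open WellOrder α using (_<_; _<?_)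
  open IsLimit lim using (_+1; β<β+1)
  open Tree n α
  open Semantics (𝔗 lim)

  -- The tree order and appending a letter.

  ⊆-trans : ∀ {x y z} → x ⊆ y → y ⊆ z → x ⊆ z
  ⊆-trans x⊆y y⊆z β β<x with x⊆y β β<x
  ... | β<y , eq = map₂ (trans eq) (y⊆z β β<y)

  ⊆-antisym : ∀ {x y} → x ⊆ y → y ⊆ x → x ≈ y
  ⊆-antisym {x} {y} x⊆y y⊆x with compare (ht x) (ht y)
  ... | tri< p _ _ = contradiction (proj₁ (y⊆x _ p)) (<-irrefl refl)
  ... | tri≈ _ p _ = p , λ β q _ → proj₂ (x⊆y β q)
  ... | tri> _ _ p = contradiction (proj₁ (x⊆y _ p)) (<-irrefl refl)

  ≈⇒⊆ : ∀ {x y} → x ≈ y → x ⊆ y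
  ≈⇒⊆ (refl , eq) β p = p , eq β p p

  ≈⇒⊇ : ∀ {x y} → x ≈ y → y ⊆ x
  ≈⇒⊇ (refl , eq) β p = p , sym (eq β p p)

  ⊆-connex-below : ∀ {x y z} → x ⊆ y → z ⊆ y → x ⊆ z ⊎ z ⊆ x
  ⊆-connex-below {x} {y} {z} x⊆y z⊆y with ht z <? ht x
  ... | yes z<x = inj₂ λ β β<z → let β<x = <-trans β<z z<x in
                    β<x , trans (proj₂ (z⊆y β β<z)) (sym (proj₂ (x⊆y β β<x)))
  ... | no  z≮x = inj₁ λ β β<x → let β<z = <-≮-trans β<x z≮x in
                    β<z , trans (proj₂ (x⊆y β β<x)) (sym (proj₂ (z⊆y β β<z)))

  extendEntry-< : ∀ x j {β} (p : β < ht x) → extendEntry lim x j β ≡ entry x β p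
  extendEntry-< x j {β} p with β <? ht x
  ... | yes _ = refl
  ... | no ¬p = contradiction p ¬p

  extendEntry-≮ : ∀ x j {β} → ¬ (β < ht x) → extendEntry lim x j β ≡ j
  extendEntry-≮ x j {β} ¬p with β <? ht x
  ... | yes p = contradiction p ¬p
  ... | no  _ = refl

  ⊆-extend : ∀ j x → x ⊆ extend lim j x
  ⊆-extend j x β p = <-trans p (β<β+1 _) , sym (extendEntry-< x j p)

  -- Powers of a letter, and prepending `i` to a node.

  infix 8 _^_
  _^_ : Fin n → ℕ → Node
  j ^ k = node (fin k) (λ _ _ → j)

  ^-mono : ∀ {j k} → j ≤ k → i ^ j ⊆ i ^ k
  ^-mono j≤k β p = fin-mono j≤k p , refl

  -- Since `fin k` lies below `ht x +1`, `ht x` is at least `fin k`, so positions below `fin k` are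
  -- not affected by the appended letter.
  ^-extend : ∀ k {j x} → i ^ suc k ⊆ extend lim j x → i ^ k ⊆ x
  ^-extend k {j} {x} s β β<k =
    β<x , trans (proj₂ (s β (<-trans β<k (β<β+1 _)))) (extendEntry-< x j β<x)
    where
    β<x : β < ht x
    β<x = <-≮-trans β<k (<+1⇒≯ (proj₁ (s (fin k) (β<β+1 _))))

  -- Inserting a letter into an initial run of `i` amounts to prepending `i`, so no position of
  -- insertion is recorded. Being a relation, it applies to powers, extensions and preimages without
  -- comparing them to `cons x`.
  record Cons (x y : Node) : Set (a ⊔ ℓ) where
    field
      ht-cons : ht y ≡ 1+ ht x
      head    : ∀ (p : 0̂ < ht y) → entry y 0̂ p ≡ i
      tail    : ∀ β (p : β < ht x) (q : (1+ β) < ht y) → entry y (1+ β) q ≡ entry x β p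

    1+-< : ∀ {β} → β < ht x → (1+ β) < ht y
    1+-< p = subst (_ <_) (sym ht-cons) (1+-mono-< p)

    1+-<⁻¹ : ∀ {β} → (1+ β) < ht y → β < ht x
    1+-<⁻¹ p = 1+-cancel-< (subst (_ <_) ht-cons p)

  open Cons

  consEntry : ∀ x {β} → View β → .(β < (1+ ht x)) → Fin n
  consEntry x zero    _ = i
  consEntry x (suc γ) p = entry x γ (1+-cancel-< p)

  cons : Node → Node
  cons x = node (1+ ht x) (λ β → consEntry x (view β))

  Cons-cons : ∀ x → Cons x (cons x)
  Cons-cons x = record
    { ht-cons = refl
    ; head    = λ p → consEntry-0̂ (view 0̂) refl p
    ; tail    = λ β p q → consEntry-1+ (view (1+ β)) refl p q
    }
    where
    -- `view` is stuck on `em`, so the claim is generalised to an arbitrary view and an equation for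
    -- its index.
    consEntry-0̂ : ∀ {β} (v : View β) → β ≡ 0̂ → (p : β < (1+ ht x)) → consEntry x v p ≡ i
    consEntry-0̂ zero    _  _ = refl
    consEntry-0̂ (suc γ) eq _ = contradiction (subst (0̂ <_) eq (0̂<1+ γ)) ≮0̂

    consEntry-1+ : ∀ {β γ} (v : View γ) → γ ≡ 1+ β → (p : β < ht x) (q : γ < (1+ ht x)) →
                   consEntry x v q ≡ entry x β p
    consEntry-1+ {β} zero eq _ _ = contradiction (subst (0̂ <_) (sym eq) (0̂<1+ β)) ≮0̂
    consEntry-1+ (suc γ) eq _ _ with 1+-injective eq
    ... | refl = refl

  uncons : ∀ y → i ^ 1 ⊆ y → ∃ λ x → Cons x y
  uncons (node h e) i⊆y with view h
  ... | zero  = contradiction (proj₁ (i⊆y 0̂ (β<β+1 0̂))) (<-irrefl refl)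
  ... | suc γ = node γ (λ β p → e (1+ β) (1+-mono-< p)) , record
    { ht-cons = refl
    ; head    = λ _ → sym (proj₂ (i⊆y 0̂ (β<β+1 0̂)))
    ; tail    = λ _ _ _ → refl
    }

  Cons-^ : ∀ k → Cons (i ^ k) (i ^ suc k)
  Cons-^ k = record
    { ht-cons = sym (1+-finite (finite k))
    ; head    = λ _ → refl
    ; tail    = λ _ _ _ → refl
    }

  -- `1+_` matches the positions of a node with the nonzero positions of its image, and position
  -- zero carries `i` in both images. Combined with `Cons-^`, this also shifts thresholds by one.
  Cons-⊆ : ∀ {x x′ y y′} → Cons x x′ → Cons y y′ → x ⊆ y ⇔ x′ ⊆ y′
  Cons-⊆ {x} {x′} {y} {y′} c d = mk⇔ (λ s β → ⇒ s (view β)) ⇐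
    where
    ⇒ : x ⊆ y → ∀ {β} → View β → (p : β < ht x′) →
        ∃ λ (q : β < ht y′) → entry x′ β p ≡ entry y′ β q
    ⇒ s zero    p = 0<y′ , trans (head c p) (sym (head d 0<y′))
      where
      0<y′ : 0̂ < ht y′
      0<y′ = subst (0̂ <_) (sym (ht-cons d)) (0̂<1+ _)
    ⇒ s (suc β) p with s β (1+-<⁻¹ c p)
    ... | β<y , eq = 1+-< d β<y ,
      trans (tail c β (1+-<⁻¹ c p) p) (trans eq (sym (tail d β β<y (1+-< d β<y))))

    ⇐ : x′ ⊆ y′ → x ⊆ y
    ⇐ s β p with s (1+ β) (1+-< c p)
    ... | q , eq = 1+-<⁻¹ d q ,
      trans (sym (tail c β p (1+-< c p))) (trans eq (tail d β (1+-<⁻¹ d q) q))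

  Cons-extend : ∀ {x y} j → Cons x y → Cons (extend lim j x) (extend lim j y)
  Cons-extend {x} {y} j c = record
    { ht-cons = trans (cong _+1 (ht-cons c)) (sym (1+-+1 (ht x)))
    ; head    = head′
    ; tail    = tail′
    }
    where
    head′ : 0̂ < (ht y +1) → extendEntry lim y j 0̂ ≡ i
    head′ _ = trans (extendEntry-< y j 0<y) (head c 0<y)
      where
      0<y : 0̂ < ht y
      0<y = subst (0̂ <_) (sym (ht-cons c)) (0̂<1+ _)

    tail′ : ∀ β → β < (ht x +1) → (1+ β) < (ht y +1) →
            extendEntry lim y j (1+ β) ≡ extendEntry lim x j β
    tail′ β _ _ with β <? ht x
    ... | yes p = trans (extendEntry-< y j (1+-< c p)) (tail c β p (1+-< c p))
    ... | no ¬p = extendEntry-≮ y j (¬p ∘ 1+-<⁻¹ c)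

  -- The partial isomorphism and its two thresholds.

  -- When `lo ≤ hi` the two cases exclude each other, and a node extending `i ^ lo` but not `i ^ hi`
  -- has no partner.
  data Match (lo hi : ℕ) : Node → Node → Set (a ⊔ ℓ) where
    low  : ∀ {x}   → ¬ (i ^ lo ⊆ x)          → Match lo hi x x
    high : ∀ {x y} → i ^ hi ⊆ x → Cons x y   → Match lo hi x y

  private
    variable
      lo lo′ hi hi′ : ℕ
      x x′ y y′ : Node
      ρ ρ′ : Vec Node k

  Match-mono : lo ≤ lo′ → hi′ ≤ hi → Match lo hi x y → Match lo′ hi′ x y
  Match-mono p q (low ¬s)   = low (¬s ∘ ⊆-trans (^-mono p))
  Match-mono p q (high s c) = high (⊆-trans (^-mono q) s) c

  high⇒image-high : ∀ hi → i ^ hi ⊆ x → Cons x y → i ^ hi ⊆ y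
  high⇒image-high hi s c = ⊆-trans (^-mono (ℕ.n≤1+n hi)) (to (Cons-⊆ (Cons-^ hi) c) s)

  -- The right-hand side does not mention y, so x cannot detect a letter inserted into y.
  low⊆high : ∀ lo → ¬ (i ^ lo ⊆ x) → i ^ lo ⊆ y → x ⊆ y ⇔ x ⊆ i ^ lo
  low⊆high lo ¬s t = mk⇔
    (λ x⊆y → [ id , (λ s → contradiction s ¬s) ]′ (⊆-connex-below x⊆y t))
    (λ x⊆i → ⊆-trans x⊆i t)

  Match-⊆ : lo ≤ hi → Match lo hi x x′ → Match lo hi y y′ → x ⊆ y ⇔ x′ ⊆ y′
  Match-⊆ p (low _)    (low _)    = mk⇔ id id
  Match-⊆ p (high _ c) (high _ d) = Cons-⊆ c d
  Match-⊆ {lo} {hi} p (low ¬s)   (high t d) =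
    ⇔-trans (low⊆high lo ¬s (⊆-trans (^-mono p) t))
      (⇔-sym (low⊆high lo ¬s (⊆-trans (^-mono p) (high⇒image-high hi t d))))
  -- Neither side can hold: a low node above a high one, or above its image, would extend `i ^ lo`.
  Match-⊆ {lo} {hi} p (high s c) (low ¬t)   = mk⇔
    (λ x⊆y → contradiction (⊆-trans (⊆-trans (^-mono p) s) x⊆y) ¬t)
    (λ x⊆y → contradiction (⊆-trans (⊆-trans (^-mono p) (high⇒image-high hi s c)) x⊆y) ¬t)

  -- Antisymmetry reduces equality to two inclusions, so no new case analysis is needed.
  Match-≈ : lo ≤ hi → Match lo hi x x′ → Match lo hi y y′ → x ≈ y ⇔ x′ ≈ y′
  Match-≈ p m m′ = mk⇔
    (λ e → ⊆-antisym (to (Match-⊆ p m m′) (≈⇒⊆ e)) (to (Match-⊆ p m′ m) (≈⇒⊇ e)))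
    (λ e → ⊆-antisym (from (Match-⊆ p m m′) (≈⇒⊆ e)) (from (Match-⊆ p m′ m) (≈⇒⊇ e)))

  -- A prefix `i ^ hi` survives appending, so `hi` stays; a low node can gain one letter of `i`, so
  -- `lo` rises by one.
  Match-extend : ∀ j → Match lo hi x y → Match (suc lo) hi (extend lim j x) (extend lim j y)
  Match-extend {lo} j (low ¬s) = low (¬s ∘ ^-extend lo)
  Match-extend j (high s c)     = high (⊆-trans s (⊆-extend j _)) (Cons-extend j c)

  Match-⟦⟧ : (t : Term n k) → Pointwise (Match lo hi) ρ ρ′ →
             Match (depth t + lo) hi (⟦ t ⟧ ρ) (⟦ t ⟧ ρ′)
  Match-⟦⟧ (var v) ms = Pointwise.lookup ms v
  Match-⟦⟧ (S j t) ms = Match-extend j (Match-⟦⟧ t ms)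

  Match-⟦⟧₂ : (s t : Term n k) → Pointwise (Match lo hi) ρ ρ′ →
              let d = depth s ℕ.⊔ depth t in
              Match (d + lo) hi (⟦ s ⟧ ρ) (⟦ s ⟧ ρ′) × Match (d + lo) hi (⟦ t ⟧ ρ) (⟦ t ⟧ ρ′)
  Match-⟦⟧₂ {lo = lo} s t ms =
      Match-mono (ℕ.+-monoˡ-≤ lo (ℕ.m≤m⊔n _ _)) ℕ.≤-refl (Match-⟦⟧ s ms)
    , Match-mono (ℕ.+-monoˡ-≤ lo (ℕ.m≤n⊔m _ _)) ℕ.≤-refl (Match-⟦⟧ t ms)

  -- The back-and-forth game and undefinability.

  Gap : ℕ → Vec Node k → Vec Node k → Set (a ⊔ ℓ)
  Gap r ρ ρ′ = ∃ λ lo → ∃ λ hi → r + lo ≤ hi × Pointwise (Match lo hi) ρ ρ′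

  Gap-≤ : ∀ {r s} → r ≤ s → Gap s ρ ρ′ → Gap r ρ ρ′
  Gap-≤ r≤s (lo , hi , gap , ms) = lo , hi , ℕ.≤-trans (ℕ.+-monoˡ-≤ lo r≤s) gap , ms

  module _ (r : ℕ) where
    private
      upper : ∀ lo → suc (r + r) + lo ≤ hi → r + suc (r + lo) ≤ hi
      upper {hi} lo = subst (_≤ hi) (trans (cong suc (ℕ.+-assoc r r lo)) (sym (ℕ.+-suc r (r + lo))))

    forth : Gap (suc (r + r)) ρ ρ′ → ∀ x → ∃ λ x′ → Gap r (x ∷ ρ) (x′ ∷ ρ′)
    forth (lo , hi , gap , ms) x with em {i ^ suc (r + lo) ⊆ x}
    -- The midpoint becomes the new `hi`, leaving the lower part of the gap.
    ... | yes s = cons x , lo , suc (r + lo) , ℕ.n≤1+n _ ,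
      high s (Cons-cons x) ∷ Pointwise.map (Match-mono ℕ.≤-refl (ℕ.m+n≤o⇒n≤o r (upper lo gap))) ms
    -- The midpoint becomes the new `lo`, leaving the upper part.
    ... | no ¬s = x , suc (r + lo) , hi , upper lo gap ,
      low ¬s ∷ Pointwise.map (Match-mono (ℕ.m≤n+m lo (suc r)) ℕ.≤-refl) ms

    back : Gap (suc (r + r)) ρ ρ′ → ∀ x′ → ∃ λ x → Gap r (x ∷ ρ) (x′ ∷ ρ′)
    back (lo , hi , gap , ms) x′ with em {i ^ suc (r + lo) ⊆ x′}
    ... | yes s with uncons x′ (⊆-trans (^-mono (s≤s (z≤n {r + lo}))) s)
    -- The preimage loses one letter, so the new `hi` is `r + lo`, one below the midpoint. The extra
    -- `suc` in the rank of a quantifier pays for this.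
    ...   | x , c = x , lo , r + lo , ℕ.≤-refl ,
      high (from (Cons-⊆ (Cons-^ (r + lo)) c) s) c ∷
      Pointwise.map (Match-mono ℕ.≤-refl (ℕ.<⇒≤ (ℕ.m+n≤o⇒n≤o r (upper lo gap)))) ms
    back (lo , hi , gap , ms) x′ | no ¬s = x′ , suc (r + lo) , hi , upper lo gap ,
      low ¬s ∷ Pointwise.map (Match-mono (ℕ.m≤n+m lo (suc r)) ℕ.≤-refl) ms

  ⊨-invariant : (φ : Formula n k) → Gap (rank φ) ρ ρ′ → (ρ ⊨ φ) ⇔ (ρ′ ⊨ φ)
  ⊨-invariant (s ≐ t) (_ , _ , gap , ms) = let m , m′ = Match-⟦⟧₂ s t ms in
    mk⇔ (λ (lift e) → lift (to (Match-≈ gap m m′) e))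
        (λ (lift e) → lift (from (Match-≈ gap m m′) e))
  ⊨-invariant (s ⊆′ t) (_ , _ , gap , ms) = let m , m′ = Match-⟦⟧₂ s t ms in
    mk⇔ (λ (lift e) → lift (to (Match-⊆ gap m m′) e))
        (λ (lift e) → lift (from (Match-⊆ gap m m′) e))
  ⊨-invariant ⊥′       g = mk⇔ id id
  ⊨-invariant (¬′ φ)   g = let e = ⊨-invariant φ g in mk⇔ (_∘ from e) (_∘ to e)
  ⊨-invariant (φ ∧′ ψ) g =
    let e = ⊨-invariant φ (Gap-≤ (ℕ.m≤m⊔n _ _) g)
        f = ⊨-invariant ψ (Gap-≤ (ℕ.m≤n⊔m _ _) g)
    in mk⇔ (Product.map (to e) (to f)) (Product.map (from e) (from f))
  ⊨-invariant (φ ∨′ ψ) g =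
    let e = ⊨-invariant φ (Gap-≤ (ℕ.m≤m⊔n _ _) g)
        f = ⊨-invariant ψ (Gap-≤ (ℕ.m≤n⊔m _ _) g)
    in mk⇔ (Sum.map (to e) (to f)) (Sum.map (from e) (from f))
  ⊨-invariant (φ ⇒′ ψ) g =
    let e = ⊨-invariant φ (Gap-≤ (ℕ.m≤m⊔n _ _) g)
        f = ⊨-invariant ψ (Gap-≤ (ℕ.m≤n⊔m _ _) g)
    in mk⇔ (λ h → to f ∘ h ∘ from e) (λ h → from f ∘ h ∘ to e)
  ⊨-invariant (∀′ φ) g = mk⇔
    (λ h x′ → let x , g′ = back (rank φ) g x′ in to (⊨-invariant φ g′) (h x))
    (λ h x → let x′ , g′ = forth (rank φ) g x in from (⊨-invariant φ g′) (h x′))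
  ⊨-invariant (∃′ φ) g = mk⇔
    (λ (x , h) → let x′ , g′ = forth (rank φ) g x in x′ , to (⊨-invariant φ g′) h)
    (λ (x′ , h) → let x , g′ = back (rank φ) g x′ in x , from (⊨-invariant φ g′) h)

  H-undefinable : (j : Fin n) → j ≢ i → ¬ Definable₂ (𝔗 lim) H
  H-undefinable j j≢i (φ , defines) =
    -- Equal heights for (`j ^ K`, `i ^ K`) transfer to (`j ^ K`, `i ^ suc K`), making `fin K` equal
    -- to its successor.
    <-irrefl (to (defines _ _) (to (⊨-invariant φ gap) (from (defines _ _) refl))) (β<β+1 (fin K))
    where
    K = rank φ + 1

    gap : Gap (rank φ) (j ^ K ∷ i ^ K ∷ []) (j ^ K ∷ i ^ suc K ∷ [])
    -- `lo` is 1 because `j ^ K` must be low and every node extends `i ^ 0`; hence the `+ 1` in `K`.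
    gap = 1 , K , ℕ.≤-refl ,
      low (λ s → j≢i (sym (proj₂ (s 0̂ (β<β+1 0̂))))) ∷ high (λ _ p → p , refl) (Cons-^ K) ∷ []

theorem26 : ∀ {a ℓ : Level} → ExcludedMiddle (a ⊔ ℓ) →
    (n : ℕ) → 2 ≤ n →
    (α : WellOrder a ℓ) (lim : IsLimit α) →
    ¬ Definable₂ (Tree.𝔗 n α lim) (Tree.H n α)
-- `2 ≤ n` provides two letters: `zero` is the inserted `i`, `suc zero` the fixed `j`.
theorem26 em _ (s≤s (s≤s _)) α lim = Game.H-undefinable em α lim (suc zero) zero λ ()
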